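{- Fix an unshifted or a shifted skew shape $\mu/\lambda$ and let $n = |\mu/\lambda|$ be its number of cells. Let $P, Q$ be two standard skew tableaux (shifted standard skew tableaux in the shifted case) of shape $\mu/\lambda$, and let $\pi$ be a permutation of $\{1,2,\dots,n\}$. Then $$\operatorname{MJ}_P(P_\pi) = Q \iff \operatorname{MJ}_Q(Q_{\pi^{ -1}}) = P,$$ where $\operatorname{MJ}_S(T)$ denotes the result of modified jeu de taquin in the tabloid $T$ with respect to $S$, and $S_\pi$ denotes the tabloid obtained from $S$ by replacing every entry $i$ by $\pi(i)$.
   Context: **Shapes.** A partition is a sequence of integers $\lambda = (\lambda_1,\dots,\lambda_r)$ with $\lambda_1 \ge \dots \ge \lambda_r \ge 0$ (trailing zeros are allowed, so that two partitions can be written with the same number $r$ of components). Cells are pairs $(i,j)$ = (row, column), with rows numbered from top to bottom and columns from left to right. The unshifted Ferrers diagram of $\lambda$ consists of the cells $(i,j)$ with $1\le i\le r$, $1 \le j \le \lambda_i$. If the nonzero components of $\lambda$ are distinct, the shifted Ferrers diagram of $\lambda$ consists of the cells $(i,j)$ with $1\le i\le r$, $i \le j \le i+\lambda_i-1$ (each row is indented by one cell to the right with respect to the previous row). If $\mu=(\mu_1,\dots,\mu_r)$ and $\lambda=(\lambda_1,\dots,\lambda_r)$ are partitions (in the shifted case, partitions with distinct nonzero components) with $\lambda_i \le \mu_i$ for all $1\le i \le r$, the unshifted (resp. shifted) skew Ferrers diagram of shape $\mu/\lambda$ is obtained by removing the cells of the unshifted (resp. shifted) Ferrers diagram of $\lambda$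 from that of $\mu$. Its number of cells is $n = |\mu/\lambda|$. **Tabloids and tableaux.** A tabloid of (shifted) skew shape $\mu/\lambda$ is an arbitrary filling of the cells of the (shifted) skew Ferrers diagram of $\mu/\lambda$ with $1,2,\dots,n$, each used exactly once. A (shifted) standard skew tableau is a tabloid whose entries increase along rows (left to right) and down columns (top to bottom). **Forward jeu de taquin.** Let $T$ be a tabloid and $e$ an entry of $T$. Forward jeu de taquin in $T$ with $e$ is the following procedure, where cells outside the shape are regarded as having entry $\infty$. Consider the entry to the right of $e$ and the entry below $e$; if $e$ is greater than the minimum of these two, exchange $e$ with that minimum. Repeat with $e$ in its new position until $e$ is smaller than both its right neighbour and its neighbour below. **Modified jeu de taquin.** Let $T$ be a tabloid and $S$ a (shifted) standard skew tableau of the same shape. For $1 \le k\le n$ let $e_k$ be the entry of $T$ in the cell which has label (entry) $k$ in $S$. Starting with $T$, perform successively forward jeu de taquin with $e_n$, then (in the resulting tabloid) with $e_{n-1}$, and so on, down to $e_1$. The final result, which is a (shifted) standard skew tableau, is denoted $\operatorname{MJ}_S(T)$. **Relabelling.** For a (shifted) standard skew tableau $S$ and a permutation $\pi$ of $\{1,\dots,n\}$, $S_\pi$ is the tabloid obtained from $S$ by replacing every entry $i$ by $\pi(i)$. -}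

module Defs where

open import Algebra.Construct.NaturalChoice.Min using ()
open import Data.Fin.Base as Fin using (Fin; toℕ; fromℕ<)
open import Data.Fin.Permutation using (Permutation′; transpose)
open import Data.Fin.Properties using (_<?_; ≤-totalOrder)
open import Data.Maybe.Base as Maybe using (Maybe; just; nothing)
open import Data.Nat.Base using (ℕ; suc; _+_; _∸_; _≤_; _<_)
open import Data.Nat.GeneralisedArithmetic using (fold)
import Data.Nat.Properties as ℕ
open import Data.Product.Base using (_×_)
open import Data.Vec.Base using (Vec; lookup; sum; zipWith)
import Data.Vec.Functional as Vector
open import Function.Bundles using (_↔_; Inverse)
open import Function.Construct.Composition using (_↔-∘_)
open import Relation.Binary.PropositionalEquality.Core using (_≡_; _≢_)
open import Relation.Nullary.Decidable.Core using (Dec; yes; no; _×-dec_; ¬?)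
open import Relation.Nullary.Negation.Core using (¬_)

open Inverse using (to; from)

data Kind : Set where
  unshifted shifted : Kind

-- Rows, columns and tableau entries are all numbered from 0 instead of 1.

record Partition (k : Kind) (r : ℕ) : Set where
  field
    parts      : Vec ℕ r
    decreasing : ∀ {i j} → i Fin.≤ j → lookup parts j ≤ lookup parts i
    distinct   : k ≡ shifted → ∀ {i j} → i ≢ j →
                 lookup parts i ≢ 0 → lookup parts i ≢ lookup parts j

open Partition

indent : Kind → ℕ → ℕ
indent unshifted i = 0
indent shifted   i = i

InDiagram : ∀ {k r} → Partition k r → Fin r → ℕ → Set
InDiagram {k} p i j =
  indent k (toℕ i) ≤ j × j < indent k (toℕ i) + lookup (parts p) i

inDiagram? : ∀ {k r} (p : Partition k r) i j → Dec (InDiagram p i j)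
inDiagram? {k} p i j =
  (indent k (toℕ i) ℕ.≤? j) ×-dec (j ℕ.<? indent k (toℕ i) + lookup (parts p) i)

record SkewShape : Set where
  field
    kind      : Kind
    rows      : ℕ
    outer     : Partition kind rows
    inner     : Partition kind rows
    contained : ∀ i → lookup (parts inner) i ≤ lookup (parts outer) i

  size : ℕ
  size = sum (zipWith _∸_ (parts outer) (parts inner))

  InSkew : Fin rows → ℕ → Set
  InSkew i j = InDiagram outer i j × ¬ InDiagram inner i j

  inSkew? : ∀ i j → Dec (InSkew i j)
  inSkew? i j = inDiagram? outer i j ×-dec ¬? (inDiagram? inner i j)

open SkewShape using (size)

-- The membership proof is irrelevant, so cells are equal as soon as their
-- coordinates are.
record Cell (D : SkewShape) : Set where
  constructor cell
  open SkewShape D using (rows; InSkew)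
  field
    row     : Fin rows
    col     : ℕ
    .inSkew : InSkew row col

open Cell using (row; col)

private
  variable
    D : SkewShape

cellAt : ℕ → ℕ → Maybe (Cell D)
cellAt {D} i j with i ℕ.<? SkewShape.rows D
... | no _    = nothing
... | yes i<r with SkewShape.inSkew? D (fromℕ< i<r) j
...   | no _  = nothing
...   | yes p = just (cell (fromℕ< i<r) j p)

right below : Cell D → Maybe (Cell D)
right c = cellAt (toℕ (row c)) (suc (col c))
below c = cellAt (suc (toℕ (row c))) (col c)

Tabloid : SkewShape → Set
Tabloid D = Cell D ↔ Fin (size D)

infix 4 _≈_
_≈_ : Tabloid D → Tabloid D → Set
T ≈ U = ∀ c → to T c ≡ to U c

record IsStandard (T : Tabloid D) : Set where
  field
    rowIncreasing : ∀ {c d} → row c ≡ row d → col c < col d → to T c Fin.< to T d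
    colIncreasing : ∀ {c d} → col c ≡ col d → row c Fin.< row d → to T c Fin.< to T d

record StandardTableau (D : SkewShape) : Set where
  field
    tabloid    : Tabloid D
    isStandard : IsStandard tabloid

open StandardTableau

relabel : StandardTableau D → Permutation′ (size D) → Tabloid D
relabel S π = π ↔-∘ tabloid S

-- Minimum of two entries, where `nothing` stands for the entry ∞.
min∞ : ∀ {n} → Maybe (Fin n) → Maybe (Fin n) → Maybe (Fin n)
min∞ nothing  y        = y
min∞ (just x) nothing  = just x
min∞ (just x) (just y) = just (x ⊓ y)
  where open Algebra.Construct.NaturalChoice.Min (≤-totalOrder _) using (_⊓_)

minNeighbour : Tabloid D → Cell D → Maybe (Fin (size D))
minNeighbour T c = min∞ (Maybe.map (to T) (right c)) (Maybe.map (to T) (below c))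

exchange : Fin (size D) → Fin (size D) → Tabloid D → Tabloid D
exchange x y T = transpose x y ↔-∘ T

slide : Fin (size D) → Tabloid D → Tabloid D
slide e T with minNeighbour T (from T e)
... | nothing = T
... | just m with m <? e
...   | yes _   = exchange e m T
...   | no _    = T

-- `slide e` fixes a tabloid in which e has come to rest, and every proper
-- slide moves e to a cell it has not visited before, so `size D` iterations
-- always reach the end of the procedure.
jeuDeTaquin : Fin (size D) → Tabloid D → Tabloid D
jeuDeTaquin {D} e T = fold T (slide e) (size D)

-- `foldr` performs the step for the largest label of S first.
MJ : StandardTableau D → Tabloid D → Tabloid D
MJ S T = Vector.foldr jeuDeTaquin T (λ k → to T (from (tabloid S) k))

{-# OPTIONS --safe #-}

-- Record, for each step of MJ_P(P_π) and each entry m, the cell h of the sliding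
-- entry after it has met all entries below m and the cell v of m itself.  These
-- cells label the edges of an n × n grid: P labels the bottom side, MJ_P(P_π)
-- labels the left side, and at the square (k, m) the path of π k meets m, where
-- the two either change places (if m is next to the sliding entry) or do not
-- interact.  Since MJ sorts the part already processed, m is never immediately
-- left of or above the sliding entry, which makes this local rule invariant
-- under transposition of the grid.  The transposed diagram has Q on its bottom
-- side and belongs to π⁻¹, and a diagram is determined by its permutation and
-- bottom side, so its left side P is MJ_Q(Q_π⁻¹).
module Submission where

open import Defs
open import Algebra.Construct.NaturalChoice.Min using ()
open import Data.Fin.Base as Fin using (Fin; toℕ; fromℕ<)
import Data.Fin.Permutation.Components as Components
open import Data.Fin.Permutation using (Permutation′; flip; _⟨$⟩ʳ_; _⟨$⟩ˡ_; inverseˡ; inverseʳ)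
open import Data.Fin.Properties as Fin using (toℕ-injective; toℕ<n; toℕ-fromℕ<; fromℕ<-toℕ; inj⇒≟)
open import Data.Maybe.Base as Maybe using (Maybe; just; nothing)
open import Data.Maybe.Properties using (≡-dec)
open import Data.Nat.Base using (ℕ; zero; suc; _≤_; _<_; z≤n; s≤s; z<s; s<s)
open import Data.Nat.GeneralisedArithmetic using (fold)
open import Data.Nat.Properties as ℕ
  using (≤-refl; ≤-reflexive; ≤-trans; <-irrefl; <-asym; <⇒≤; <⇒≱; ≰⇒>; ≮⇒≥; m<1+n⇒m≤n)
open import Data.Product.Base using (_×_; _,_; proj₁; proj₂; ∃-syntax)
open import Data.Sum.Base using (_⊎_; inj₁; inj₂)
import Data.Vec.Functional as Vector
open import Function.Base using (_∘_)
open import Function.Bundles using (_⇔_; mk⇔; module Inverse)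
open import Function.Properties.Inverse using (↔⇒↣)
open import Relation.Binary.Definitions using (DecidableEquality; Decidable; tri<; tri≈; tri>)
open import Relation.Binary.PropositionalEquality
  using (_≡_; _≢_; refl; sym; trans; cong; subst; subst₂; _≗_; module ≡-Reasoning)
open import Relation.Nullary.Decidable using (yes; no; dec-true; dec-false; _⊎-dec_)
open import Relation.Nullary.Negation.Core using (¬_; contradiction)

open SkewShape using (size)
open StandardTableau using (tabloid; isStandard)
open IsStandard using (rowIncreasing; colIncreasing)
open Cell using (row; col)
open Inverse using (to; from; strictlyInverseˡ; strictlyInverseʳ)

-- Induction over stages.

-- `B` lives on the n + 1 grid lines and the step on the n strips between them, hence `ℕ` for the
-- one and `Fin n` for the other.
downward : ∀ {n} (B : ℕ → Set) → B n →
           (∀ (k : Fin n) → B (suc (toℕ k)) → B (toℕ k)) →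
           ∀ j → j ≤ n → B j
downward {zero}  B base step zero    _         = base
downward {suc n} B base step zero    _         =
  step Fin.zero (downward (B ∘ suc) base (step ∘ Fin.suc) zero z≤n)
downward {suc n} B base step (suc j) (s≤s j≤n) =
  downward (B ∘ suc) base (step ∘ Fin.suc) j j≤n

upward : ∀ {n} (e : Fin n) (B : ℕ → Set) → B 0 →
         (∀ (m : Fin n) → m Fin.< e → B (toℕ m) → B (suc (toℕ m))) →
         ∀ j → j ≤ toℕ e → B j
upward e           B base step zero    _         = base
upward (Fin.suc e) B base step (suc j) (s≤s j≤e) =
  upward e (B ∘ suc) (step Fin.zero z<s base)
         (λ m m<e → step (Fin.suc m) (s<s m<e)) j j≤e

-- Growth diagrams.

module _ {n} (π : Permutation′ n) where

  later-column : ∀ {k m} → k Fin.≤ π ⟨$⟩ˡ m → m ≢ π ⟨$⟩ʳ k → k Fin.< π ⟨$⟩ˡ m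
  later-column k≤ m≢ = Fin.≤∧≢⇒< k≤ λ k≡ → m≢ (trans (sym (inverseʳ π)) (cong (π ⟨$⟩ʳ_) (sym k≡)))

-- `y` and `x` are the incoming cells of the sliding entry and of the entry it meets; the last two
-- indices are their outgoing cells. `stays` excludes both directions of adjacency because
-- transposition interchanges them.
data Square {C : Set} (Adj : C → C → Set) (y x : C) : C → C → Set where
  moves : Adj y x → Square Adj y x x y
  stays : ¬ Adj y x → ¬ Adj x y → Square Adj y x y x

-- The transposed square is traversed backwards, from the outgoing edges to the incoming ones. A
-- move is undone across the same adjacency, and a stay swaps its two negations.
square-sym : ∀ {C : Set} {Adj : C → C → Set} {y x h v} →
             Square Adj y x h v → Square Adj v h x y
square-sym (moves a)    = moves a
square-sym (stays b b′) = stays b′ b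

square-det : ∀ {C : Set} {Adj : C → C → Set} {y y′ x x′ h h′ v v′} →
             y ≡ y′ → x ≡ x′ → Square Adj y x h v → Square Adj y′ x′ h′ v′ →
             h ≡ h′ × v ≡ v′
square-det refl refl (moves _)   (moves _)   = refl , refl
square-det refl refl (moves a)   (stays b _) = contradiction a b
square-det refl refl (stays b _) (moves a)   = contradiction a b
square-det refl refl (stays _ _) (stays _ _) = refl , refl

-- `v k m` is the cell of the entry m while the labels below k are still to be
-- processed, and `h k m` is the cell of the sliding entry π k once it has been
-- compared with all entries below m.  Only the values with k ≤ π⁻¹ m and
-- m ≤ π k, respectively, are constrained.
record Growth {C : Set} (Adj : C → C → Set) {n} (π : Permutation′ n) (p q : Fin n → C) : Set where
  field
    h         : Fin n → ℕ → C
    v         : ℕ → Fin n → C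
    bottom    : ∀ k → h k 0 ≡ p k
    left      : ∀ m → v 0 m ≡ q m
    corner    : ∀ k → h k (toℕ (π ⟨$⟩ʳ k)) ≡ v (toℕ k) (π ⟨$⟩ʳ k)
    hstraight : ∀ {k m} → m Fin.< π ⟨$⟩ʳ k → π ⟨$⟩ˡ m Fin.< k →
                h k (suc (toℕ m)) ≡ h k (toℕ m)
    vstraight : ∀ {k m} → π ⟨$⟩ʳ k Fin.< m → k Fin.< π ⟨$⟩ˡ m →
                v (toℕ k) m ≡ v (suc (toℕ k)) m
    square    : ∀ {k m} → m Fin.< π ⟨$⟩ʳ k → k Fin.< π ⟨$⟩ˡ m →
                Square Adj (h k (toℕ m)) (v (suc (toℕ k)) m) (h k (suc (toℕ m))) (v (toℕ k) m)

module _ {C : Set} {Adj : C → C → Set} {n} {π : Permutation′ n} where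

  growth-transpose : ∀ {p q} → Growth Adj π p q → Growth Adj (flip π) q p
  growth-transpose G = record
    { h         = λ k m → v m k
    ; v         = λ k m → h m k
    ; bottom    = left
    ; left      = bottom
    ; corner    = λ m → subst (λ i → v (toℕ (π ⟨$⟩ˡ m)) i ≡ h (π ⟨$⟩ˡ m) (toℕ i))
                              (inverseʳ π) (sym (corner (π ⟨$⟩ˡ m)))
    ; hstraight = λ m< <k → sym (vstraight <k m<)
    ; vstraight = λ π< k< → sym (hstraight k< π<)
    ; square    = λ m< k< → square-sym (square k< m<)
    }
    where open Growth G

  -- The strips are filled from the largest k down to 0, each from its bottom edge up to the corner
  -- at π k. Every edge is then forced by edges already known.
  growth-unique : ∀ {p p′ q q′} → p ≗ p′ → Growth Adj π p q → Growth Adj π p′ q′ → q ≗ q′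
  growth-unique {p} {p′} p≗p′ G G′ m =
    trans (sym (G.left m)) (trans (downward V-Agree base row-step 0 z≤n m z≤n) (G′.left m))
    where
    module G  = Growth G
    module G′ = Growth G′

    -- Only the constrained edges are compared: there are none at stage n, and at stage 0 every
    -- entry has one.
    V-Agree : ℕ → Set
    V-Agree j = ∀ m → j ≤ toℕ (π ⟨$⟩ˡ m) → G.v j m ≡ G′.v j m

    base : V-Agree n
    base m n≤ = contradiction n≤ (<⇒≱ (toℕ<n (π ⟨$⟩ˡ m)))

    row-step : ∀ k → V-Agree (suc (toℕ k)) → V-Agree (toℕ k)
    row-step k v-agree = v-agree′
      where
      h-step : ∀ m → m Fin.< π ⟨$⟩ʳ k → G.h k (toℕ m) ≡ G′.h k (toℕ m) →
               G.h k (suc (toℕ m)) ≡ G′.h k (suc (toℕ m))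
      h-step m m< ih with Fin.<-cmp k (π ⟨$⟩ˡ m)
      ... | tri< k< _ _ = proj₁ (square-det ih (v-agree m k<) (G.square m< k<) (G′.square m< k<))
      ... | tri≈ _ k≡ _ = contradiction (trans (sym (inverseʳ π)) (cong (π ⟨$⟩ʳ_) (sym k≡))) (Fin.<⇒≢ m<)
      ... | tri> _ _ <k = trans (G.hstraight m< <k) (trans ih (sym (G′.hstraight m< <k)))

      h-agree : ∀ j → j ≤ toℕ (π ⟨$⟩ʳ k) → G.h k j ≡ G′.h k j
      h-agree = upward (π ⟨$⟩ʳ k) _ (trans (G.bottom k) (trans (p≗p′ k) (sym (G′.bottom k)))) h-step

      v-agree′ : V-Agree (toℕ k)
      v-agree′ m k≤ with Fin.<-cmp m (π ⟨$⟩ʳ k)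
      ... | tri≈ _ refl _ = trans (sym (G.corner k)) (trans (h-agree _ ≤-refl) (G′.corner k))
      ... | tri< m< m≢ _ = proj₂ (square-det (h-agree _ (<⇒≤ m<)) (v-agree m k<) (G.square m< k<) (G′.square m< k<))
        where k< = later-column π k≤ m≢
      ... | tri> _ m≢ <m = trans (G.vstraight <m k<) (trans (v-agree m k<) (sym (G′.vstraight <m k<)))
        where k< = later-column π k≤ m≢

-- Transpositions and scans.

module _ {n} (i j : Fin n) where

  transpose-fst : Components.transpose i j i ≡ j
  transpose-fst rewrite dec-true (i Fin.≟ i) refl = refl

  transpose-snd : i ≢ j → Components.transpose i j j ≡ i
  transpose-snd i≢j rewrite dec-false (j Fin.≟ i) (i≢j ∘ sym) | dec-true (j Fin.≟ j) refl = refl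

  transpose-other : ∀ {a} → a ≢ i → a ≢ j → Components.transpose i j a ≡ a
  transpose-other {a} a≢i a≢j rewrite dec-false (a Fin.≟ i) a≢i | dec-false (a Fin.≟ j) a≢j = refl

-- A tabloid is represented by the map from entries to cells.  Scanning the
-- entries below e in increasing order, and exchanging e with those met next to
-- it, has the same effect as jeu de taquin once the rest is sorted.
module Scan {C : Set} {Adj : C → C → Set} (adj? : Decidable Adj) {n} (e : Fin n) where

  step : Fin n → (Fin n → C) → Fin n → C
  step m f with adj? (f e) (f m)
  ... | yes _ = f ∘ Components.transpose m e
  ... | no _  = f

  scan : (Fin n → C) → ℕ → Fin n → C
  scan f zero    = f
  scan f (suc j) with j ℕ.<? n
  ... | yes j<n = step (fromℕ< j<n) (scan f j)
  -- A default value: the scans of interest stop at e, which is below n.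
  ... | no _    = scan f j

  scan-suc : ∀ f m → scan f (suc (toℕ m)) ≡ step m (scan f (toℕ m))
  scan-suc f m with toℕ m ℕ.<? n
  ... | yes m<n = cong (λ i → step i (scan f (toℕ m))) (fromℕ<-toℕ m m<n)
  ... | no m≮n  = contradiction (toℕ<n m) m≮n

  step-moves : ∀ {m f} → Adj (f e) (f m) → step m f ≡ f ∘ Components.transpose m e
  step-moves {m} {f} a with adj? (f e) (f m)
  ... | yes _ = refl
  ... | no ¬a = contradiction a ¬a

  step-stays : ∀ {m f} → ¬ Adj (f e) (f m) → step m f ≡ f
  step-stays {m} {f} ¬a with adj? (f e) (f m)
  ... | yes a = contradiction a ¬a
  ... | no _  = refl

  step-other : ∀ {m f a} → a ≢ e → a ≢ m → step m f a ≡ f a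
  step-other {m} {f} a≢e a≢m with adj? (f e) (f m)
  ... | yes _ = cong f (transpose-other m e a≢m a≢e)
  ... | no _  = refl

  -- A step tests adjacency in one direction only. Excluding the other direction turns it into the
  -- symmetric local rule.
  step-square : ∀ {m f} → m ≢ e → ¬ Adj (f m) (f e) →
                Square Adj (f e) (f m) (step m f e) (step m f m)
  step-square {m} {f} m≢e ¬b with adj? (f e) (f m)
  ... | no ¬a = stays ¬a ¬b
  ... | yes a rewrite transpose-fst m e | transpose-snd m e m≢e = moves a

  -- Apart from `e`, only the entry being met can move, so `a` changes its cell at most in its own
  -- step. This lemma and the next one identify its cells before and after that step.
  scan-later : ∀ f {a} j → a ≢ e → j ≤ toℕ a → scan f j a ≡ f a
  scan-later f {a} j a≢e = upward a (λ j → scan f j a ≡ f a) refl step′ j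
    where
    step′ : ∀ m → m Fin.< a → scan f (toℕ m) a ≡ f a → scan f (suc (toℕ m)) a ≡ f a
    step′ m m<a ih rewrite scan-suc f m =
      trans (step-other a≢e (Fin.<⇒≢ m<a ∘ sym)) ih

  scan-earlier : ∀ f {a} j → a ≢ e → toℕ a < j → j ≤ toℕ e →
                 scan f j a ≡ scan f (suc (toℕ a)) a
  scan-earlier f {a} j a≢e a<j j≤e =
    upward e (λ j → toℕ a < j → scan f j a ≡ scan f (suc (toℕ a)) a) (λ ()) step′ j j≤e a<j
    where
    step′ : ∀ m → m Fin.< e → (a Fin.< m → scan f (toℕ m) a ≡ scan f (suc (toℕ a)) a) →
            toℕ a < suc (toℕ m) → scan f (suc (toℕ m)) a ≡ scan f (suc (toℕ a)) a
    step′ m _ ih a≤m with a Fin.≟ m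
    ... | yes refl = refl
    ... | no a≢m   = trans (cong (λ g → g a) (scan-suc f m))
                           (trans (step-other a≢e a≢m) (ih (Fin.≤∧≢⇒< (m<1+n⇒m≤n a≤m) a≢m)))

  -- Idle steps change nothing, so adjacency need only be excluded in the state at stage `i`.
  scan-idle : ∀ f {i} j → i ≤ j → j ≤ toℕ e →
              (∀ m → i ≤ toℕ m → toℕ m < j → ¬ Adj (scan f i e) (scan f i m)) →
              scan f j ≡ scan f i
  scan-idle f {i} j i≤j j≤e idle = upward e B base step′ j j≤e i≤j idle
    where
    B : ℕ → Set
    B j = i ≤ j → (∀ m → i ≤ toℕ m → toℕ m < j → ¬ Adj (scan f i e) (scan f i m)) →
          scan f j ≡ scan f i

    base : B 0
    base z≤n _ = refl

    step′ : ∀ m → m Fin.< e → B (toℕ m) → B (suc (toℕ m))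
    step′ m _ ih i≤1+m idle with i ℕ.≤? toℕ m
    ... | no i≰m  = cong (scan f) (ℕ.≤-antisym (≰⇒> i≰m) i≤1+m)
    ... | yes i≤m = trans (scan-suc f m)
        (trans (step-stays (subst (λ g → ¬ Adj (g e) (g m)) (sym same) (idle m i≤m ≤-refl))) same)
      where same = ih i≤m (λ m′ i≤ m′<m → idle m′ i≤ (ℕ.m<n⇒m<1+n m′<m))

-- Invariants of sorting.

module Sifting {C : Set} {Adj : C → C → Set} (adj? : Decidable Adj) {n}
  (π : Permutation′ n) (p : Fin n → C) (label : C → ℕ)
  (label-p : ∀ k → label (p k) ≡ toℕ k)
  (label-mono : ∀ {c d} → Adj c d → label c < label d) where

  adj-irrefl : ∀ {c} → ¬ Adj c c
  adj-irrefl a = <-irrefl refl (label-mono a)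

  adj-asym : ∀ {c d} → Adj c d → ¬ Adj d c
  adj-asym a b = <-asym (label-mono a) (label-mono b)

  record Placed (k : ℕ) (f : Fin n → C) : Set where
    field
      untouched : ∀ {a} → toℕ (π ⟨$⟩ˡ a) < k → f a ≡ p (π ⟨$⟩ˡ a)
      processed : ∀ {a} → k ≤ toℕ (π ⟨$⟩ˡ a) → k ≤ label (f a)

    -- Labels grow along adjacency, whereas an untouched entry sits in a cell with label below `k`.
    beyond : ∀ {a c} → k ≤ label c → Adj c (f a) → k ≤ toℕ (π ⟨$⟩ˡ a)
    beyond k≤c a = ≮⇒≥ λ <k → <⇒≱ (ℕ.<-trans (label-mono a)
      (subst (_< k) (sym (trans (cong label (untouched <k)) (label-p _))) <k)) k≤c

  record Sorted (k : ℕ) (f : Fin n → C) : Set where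
    field
      placed : Placed k f
      order  : ∀ {a b} → k ≤ toℕ (π ⟨$⟩ˡ a) → Adj (f a) (f b) → a Fin.< b
    open Placed placed public

  module Row (k : Fin n) where

    e : Fin n
    e = π ⟨$⟩ʳ k

    open Scan adj? e

    private
      k≤π⁻¹e : k Fin.≤ π ⟨$⟩ˡ e
      k≤π⁻¹e = ≤-reflexive (cong toℕ (sym (inverseˡ π)))

    -- In mid-scan, `e` behaves as a value lying just below `j`. At `j = toℕ e` the conditions
    -- `before` and `after` supply the comparisons with `e` that `order` leaves out.
    record Sifted (j : ℕ) (f : Fin n → C) : Set where
      field
        placed : Placed (toℕ k) f
        order  : ∀ {a b} → a ≢ e → b ≢ e → k Fin.≤ π ⟨$⟩ˡ a → Adj (f a) (f b) → a Fin.< b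
        before : ∀ {a} → k Fin.≤ π ⟨$⟩ˡ a → Adj (f a) (f e) → toℕ a < j
        after  : ∀ {a} → Adj (f e) (f a) → j ≤ toℕ a
      open Placed placed public

    start : ∀ {f} → Sorted (suc (toℕ k)) f → Sifted 0 f
    start {f} s = record
      { placed = record
        { untouched = λ <k → S.untouched (ℕ.m<n⇒m<1+n <k)
        ; processed = processed′ }
      ; order  = λ a≢e _ k≤a → S.order (later-column π k≤a a≢e)
      ; before = λ k≤a a → contradiction a (no-before k≤a)
      ; after  = λ _ → z≤n
      }
      where
      module S = Sorted s

      label-e : label (f e) ≡ toℕ k
      label-e = trans (cong label (S.untouched (s≤s (≤-reflexive (cong toℕ (inverseˡ π))))))
                      (trans (label-p _) (cong toℕ (inverseˡ π)))

      processed′ : ∀ {a} → k Fin.≤ π ⟨$⟩ˡ a → toℕ k ≤ label (f a)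
      processed′ {a} k≤a with a Fin.≟ e
      ... | yes refl = ≤-reflexive (sym label-e)
      ... | no a≢e   = <⇒≤ (S.processed (later-column π k≤a a≢e))

      -- The slide starts in the cell labelled `k`, the smallest label among the cells of processed
      -- entries.
      no-before : ∀ {a} → k Fin.≤ π ⟨$⟩ˡ a → ¬ Adj (f a) (f e)
      no-before k≤a a = <⇒≱ (subst (_ <_) label-e (label-mono a)) (processed′ k≤a)

    finish : ∀ {f} → Sifted (toℕ e) f → Sorted (toℕ k) f
    finish {f} s = record { placed = S.placed ; order = order′ }
      where
      module S = Sifted s

      order′ : ∀ {a b} → k Fin.≤ π ⟨$⟩ˡ a → Adj (f a) (f b) → a Fin.< b
      order′ {a} {b} k≤a adj with a Fin.≟ e | b Fin.≟ e
      ... | yes refl | yes refl = contradiction adj adj-irrefl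
      ... | yes refl | no b≢e   = Fin.≤∧≢⇒< (S.after adj) (b≢e ∘ sym)
      ... | no _     | yes refl = S.before k≤a adj
      ... | no a≢e   | no b≢e   = S.order a≢e b≢e k≤a adj

    -- `m` inherits the neighbours of `e`, which `before` and `after` compare with `m`; `e` inherits
    -- those of `m`, which `order` compares with `m`.
    sifted-exchange : ∀ {m f g} → m Fin.< e → Adj (f e) (f m) →
                      g m ≡ f e → g e ≡ f m → (∀ {a} → a ≢ m → a ≢ e → g a ≡ f a) →
                      Sifted (toℕ m) f → Sifted (suc (toℕ m)) g
    sifted-exchange {m} {f} {g} m<e adj g-m g-e g-other s = record
      { placed = record { untouched = untouched′ ; processed = processed′ }
      ; order  = order′
      ; before = before′
      ; after  = after′
      }
      where
      module S = Sifted s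

      m≢e : m ≢ e
      m≢e = Fin.<⇒≢ m<e

      k≤m : k Fin.≤ π ⟨$⟩ˡ m
      k≤m = S.beyond (S.processed k≤π⁻¹e) adj

      untouched′ : ∀ {a} → π ⟨$⟩ˡ a Fin.< k → g a ≡ p (π ⟨$⟩ˡ a)
      untouched′ <k = trans (g-other (λ { refl → <⇒≱ <k k≤m }) (λ { refl → <⇒≱ <k k≤π⁻¹e }))
                            (S.untouched <k)

      processed′ : ∀ {a} → k Fin.≤ π ⟨$⟩ˡ a → toℕ k ≤ label (g a)
      processed′ {a} k≤a with a Fin.≟ m | a Fin.≟ e
      ... | yes refl | _        = subst (λ c → toℕ k ≤ label c) (sym g-m) (S.processed k≤π⁻¹e)
      ... | no _     | yes refl = subst (λ c → toℕ k ≤ label c) (sym g-e) (S.processed k≤m)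
      ... | no a≢m   | no a≢e   = subst (λ c → toℕ k ≤ label c) (sym (g-other a≢m a≢e)) (S.processed k≤a)

      order′ : ∀ {a b} → a ≢ e → b ≢ e → k Fin.≤ π ⟨$⟩ˡ a → Adj (g a) (g b) → a Fin.< b
      order′ {a} {b} a≢e b≢e k≤a c with a Fin.≟ m | b Fin.≟ m
      ... | yes refl | yes refl = contradiction c adj-irrefl
      ... | yes refl | no b≢m   =
        Fin.≤∧≢⇒< (S.after (subst₂ Adj g-m (g-other b≢m b≢e) c)) (b≢m ∘ sym)
      ... | no a≢m   | yes refl = S.before k≤a (subst₂ Adj (g-other a≢m a≢e) g-m c)
      ... | no a≢m   | no b≢m   =
        S.order a≢e b≢e k≤a (subst₂ Adj (g-other a≢m a≢e) (g-other b≢m b≢e) c)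

      before′ : ∀ {a} → k Fin.≤ π ⟨$⟩ˡ a → Adj (g a) (g e) → toℕ a < suc (toℕ m)
      before′ {a} k≤a c with a Fin.≟ m | a Fin.≟ e
      ... | yes refl | _        = ≤-refl
      ... | no _     | yes refl = contradiction c adj-irrefl
      ... | no a≢m   | no a≢e   =
        ℕ.m<n⇒m<1+n (S.order a≢e m≢e k≤a (subst₂ Adj (g-other a≢m a≢e) g-e c))

      after′ : ∀ {a} → Adj (g e) (g a) → suc (toℕ m) ≤ toℕ a
      after′ {a} c with a Fin.≟ m | a Fin.≟ e
      ... | yes refl | _        = contradiction (subst₂ Adj g-e g-m c) (adj-asym adj)
      ... | no _     | yes refl = contradiction c adj-irrefl
      ... | no a≢m   | no a≢e   = S.order m≢e a≢e k≤m (subst₂ Adj g-e (g-other a≢m a≢e) c)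

    sifted-step : ∀ {m f} → m Fin.< e → Sifted (toℕ m) f → Sifted (suc (toℕ m)) (step m f)
    sifted-step {m} {f} m<e s with adj? (f e) (f m)
    ... | no ¬a = record
      { placed = S.placed
      ; order  = S.order
      ; before = λ k≤a b → ℕ.m<n⇒m<1+n (S.before k≤a b)
      ; after  = λ b → Fin.≤∧≢⇒< (S.after b) λ { refl → ¬a b }
      }
      where module S = Sifted s
    ... | yes adj = sifted-exchange m<e adj
      (cong f (transpose-fst m e)) (cong f (transpose-snd m e (Fin.<⇒≢ m<e)))
      (λ a≢m a≢e → cong f (transpose-other m e a≢m a≢e)) s

    sifted : ∀ {f} → Sorted (suc (toℕ k)) f → ∀ j → j ≤ toℕ e → Sifted j (scan f j)
    sifted {f} s = upward e (λ j → Sifted j (scan f j)) (start s) λ m m<e ih →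
      subst (Sifted _) (sym (scan-suc f m)) (sifted-step m<e ih)

  sorted-cong : ∀ {k f g} → f ≗ g → Sorted k f → Sorted k g
  sorted-cong f≗g s = record
    { placed = record
      { untouched = λ <k → trans (sym (f≗g _)) (untouched <k)
      ; processed = λ k≤ → subst (λ c → _ ≤ label c) (f≗g _) (processed k≤) }
    ; order  = λ k≤ a → order k≤ (subst₂ Adj (sym (f≗g _)) (sym (f≗g _)) a)
    }
    where open Sorted s

  module _ (F : ℕ → Fin n → C) (F-last : ∀ a → F n a ≡ p (π ⟨$⟩ˡ a))
    (F-step : ∀ k → Sorted (suc (toℕ k)) (F (suc (toℕ k))) →
              F (toℕ k) ≗ Scan.scan adj? (π ⟨$⟩ʳ k) (F (suc (toℕ k))) (toℕ (π ⟨$⟩ʳ k)))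
    where

    -- Sortedness and scanning support each other: a sorted stage makes the next slide a scan by
    -- `F-step`, and that scan ends in a sorted stage.
    F-sorted : ∀ j → j ≤ n → Sorted j (F j)
    F-sorted = downward (λ j → Sorted j (F j)) last λ k s →
      sorted-cong (sym ∘ F-step k s) (Row.finish k (Row.sifted k s _ ≤-refl))
      where
      last : Sorted n (F n)
      last = record
        { placed = record
          { untouched = λ _ → F-last _
          ; processed = λ n≤ → contradiction n≤ (<⇒≱ (toℕ<n _)) }
        ; order  = λ n≤ → contradiction n≤ (<⇒≱ (toℕ<n _))
        }

    growth : Growth Adj π p (F 0)
    growth = record
      { h         = h
      ; v         = F
      ; bottom    = λ k → trans (Sorted.untouched (sorted k) (s≤s (≤-reflexive (cong toℕ (inverseˡ π)))))
                                (cong p (inverseˡ π))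
      ; left      = λ _ → refl
      ; corner    = λ k → sym (F-step k (sorted k) _)
      ; hstraight = hstraight
      ; vstraight = λ {k} {m} π< _ → trans (F-step k (sorted k) m)
          (Scan.scan-later adj? _ _ _ (Fin.<⇒≢ π< ∘ sym) (<⇒≤ π<))
      ; square    = square
      }
      where
      sorted : ∀ k → Sorted (suc (toℕ k)) (F (suc (toℕ k)))
      sorted k = F-sorted _ (toℕ<n k)

      open module S k = Scan adj? (π ⟨$⟩ʳ k)

      h : Fin n → ℕ → C
      h k j = scan k (F (suc (toℕ k))) j (π ⟨$⟩ʳ k)

      sifted : ∀ {k m} → m Fin.< π ⟨$⟩ʳ k → Row.Sifted k (toℕ m) (scan k (F (suc (toℕ k))) (toℕ m))
      sifted {k} m< = Row.sifted k (sorted k) _ (<⇒≤ m<)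

      -- By `beyond`, whatever lies right of or below the sliding entry has label at least `k`, so
      -- the unprocessed `m` is not met.
      hstraight : ∀ {k m} → m Fin.< π ⟨$⟩ʳ k → π ⟨$⟩ˡ m Fin.< k → h k (suc (toℕ m)) ≡ h k (toℕ m)
      hstraight {k} {m} m< <k = cong (λ g → g (π ⟨$⟩ʳ k))
        (trans (scan-suc k _ m) (step-stays k λ a → <⇒≱ <k (R.beyond (R.processed k≤) a)))
        where
        module R = Row.Sifted {k} (sifted m<)
        k≤ = ≤-reflexive (cong toℕ (sym (inverseˡ π)))

      square : ∀ {k m} → m Fin.< π ⟨$⟩ʳ k → k Fin.< π ⟨$⟩ˡ m →
               Square Adj (h k (toℕ m)) (F (suc (toℕ k)) m) (h k (suc (toℕ m))) (F (toℕ k) m)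
      square {k} {m} m< k<
        rewrite F-step k (sorted k) m
              | scan-earlier k (F (suc (toℕ k))) (toℕ (π ⟨$⟩ʳ k)) (Fin.<⇒≢ m<) m< ≤-refl
              | scan-suc k (F (suc (toℕ k))) m
              = subst (λ x → Square Adj (g (π ⟨$⟩ʳ k)) x (step k m g (π ⟨$⟩ʳ k)) (step k m g m))
                  (scan-later k (F (suc (toℕ k))) (toℕ m) (Fin.<⇒≢ m<) ≤-refl)
                  -- If `m` were immediately left of or above the sliding entry, `before` would make
                  -- `m` smaller than itself.
                  (step-square k {f = g} (Fin.<⇒≢ m<) λ a → <-irrefl refl (R.before (<⇒≤ k<) a))
        where
        module R = Row.Sifted {k} (sifted m<)
        g = scan k (F (suc (toℕ k))) (toℕ m)

-- Jeu de taquin as a scan.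

module _ {D : SkewShape} where

  Adj : Cell D → Cell D → Set
  Adj c d = right c ≡ just d ⊎ below c ≡ just d

  -- Equality of cells is decided by comparing their entries in `T`.
  adjacent? : Tabloid D → Decidable Adj
  adjacent? T c d = ≡-dec _≟_ (right c) (just d) ⊎-dec ≡-dec _≟_ (below c) (just d)
    where
    _≟_ : DecidableEquality (Cell D)
    _≟_ = inj⇒≟ (↔⇒↣ T)

  cellAt-just : ∀ i j {d : Cell D} → cellAt i j ≡ just d → toℕ (row d) ≡ i × col d ≡ j
  cellAt-just i j eq with i ℕ.<? SkewShape.rows D
  ... | yes i<r with SkewShape.inSkew? D (fromℕ< i<r) j | eq
  ...   | yes _ | refl = toℕ-fromℕ< i<r , refl

  standard-adj : (S : StandardTableau D) → ∀ {c d} → Adj c d →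
                 to (tabloid S) c Fin.< to (tabloid S) d
  standard-adj S {c} {d} (inj₁ eq) with cellAt-just _ _ eq
  ... | r , s = rowIncreasing (isStandard S) (toℕ-injective (sym r)) (≤-reflexive (sym s))
  standard-adj S {c} {d} (inj₂ eq) with cellAt-just _ _ eq
  ... | r , s = colIncreasing (isStandard S) (sym s) (≤-reflexive (sym r))

  module _ {n} (t : Cell D → Fin n) where

    open Algebra.Construct.NaturalChoice.Min (Fin.≤-totalOrder n) using (⊓-sel; x⊓y≤x; x⊓y≤y)

    min∞-nothing : ∀ (x y : Maybe (Cell D)) → min∞ (Maybe.map t x) (Maybe.map t y) ≡ nothing →
                   ∀ {d} → ¬ (x ≡ just d ⊎ y ≡ just d)
    min∞-nothing nothing  nothing  _ (inj₁ ())
    min∞-nothing nothing  nothing  _ (inj₂ ())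
    min∞-nothing (just _) nothing  ()
    min∞-nothing (just _) (just _) ()

    min∞-attained : ∀ (x y : Maybe (Cell D)) {m} → min∞ (Maybe.map t x) (Maybe.map t y) ≡ just m →
                    ∃[ d ] (x ≡ just d ⊎ y ≡ just d) × t d ≡ m
    min∞-attained nothing  (just d) refl = d , inj₂ refl , refl
    min∞-attained (just c) nothing  refl = c , inj₁ refl , refl
    min∞-attained (just c) (just d) refl with ⊓-sel (t c) (t d)
    ... | inj₁ eq = c , inj₁ refl , sym eq
    ... | inj₂ eq = d , inj₂ refl , sym eq

    min∞-lower : ∀ (x y : Maybe (Cell D)) {m} → min∞ (Maybe.map t x) (Maybe.map t y) ≡ just m →
                 ∀ {d} → x ≡ just d ⊎ y ≡ just d → m Fin.≤ t d
    min∞-lower nothing  (just d) refl (inj₂ refl) = ≤-refl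
    min∞-lower (just c) nothing  refl (inj₁ refl) = ≤-refl
    min∞-lower (just c) (just d) refl (inj₁ refl) = x⊓y≤x (t c) (t d)
    min∞-lower (just c) (just d) refl (inj₂ refl) = x⊓y≤y (t c) (t d)

  module _ (adj? : Decidable Adj) (e : Fin (size D)) (f : Fin (size D) → Cell D)
    (after : ∀ j → j ≤ toℕ e → ∀ {a} →
             Adj (Scan.scan adj? e f j e) (Scan.scan adj? e f j a) → j ≤ toℕ a)
    where

    open Scan adj? e

    -- By `after`, the least neighbour m is at least `j`. No smaller entry is a neighbour, so the
    -- scan idles up to m and then performs the exchange of the slide, arriving at stage m + 1. If
    -- the slide does nothing, the scan idles up to e.
    slide-scan : ∀ (U : Tabloid D) j → j ≤ toℕ e → from U ≗ scan f j →
                 ∃[ i ] i ≤ toℕ e × (j < i ⊎ i ≡ toℕ e) × from (slide e U) ≗ scan f i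
    slide-scan U j j≤e U≗ with minNeighbour U (from U e) in eq
    ... | nothing = toℕ e , ≤-refl , inj₂ refl , λ a → trans (U≗ a)
      (cong (λ g → g a) (sym (scan-idle f (toℕ e) j≤e ≤-refl λ m _ _ adj →
        min∞-nothing (to U) _ _ eq (subst (λ c → Adj c (scan f j m)) (sym (U≗ e)) adj))))
    ... | just m with m Fin.<? e
    ...   | no m≮e = toℕ e , ≤-refl , inj₂ refl , λ a → trans (U≗ a)
      (cong (λ g → g a) (sym (scan-idle f (toℕ e) j≤e ≤-refl λ m′ _ m′<e adj →
        m≮e (ℕ.≤-<-trans (subst (m Fin.≤_) (strictlyInverseˡ U m′)
          (min∞-lower (to U) _ _ eq (subst₂ Adj (sym (U≗ e)) (sym (U≗ m′)) adj))) m′<e))))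
    ...   | yes m<e = suc (toℕ m) , m<e , inj₁ (s≤s j≤m) , λ a →
      trans (U≗ _) (cong (λ g → g a) (sym (trans (scan-suc f m)
        (trans (cong (step m) idle) (step-moves adj)))))
      where
      adj : Adj (scan f j e) (scan f j m)
      adj with min∞-attained (to U) _ _ eq
      ... | d , a , refl = subst₂ Adj (U≗ e)
        (trans (sym (strictlyInverseʳ U d)) (U≗ (to U d))) a

      j≤m : j ≤ toℕ m
      j≤m = after j j≤e adj

      idle : scan f (toℕ m) ≡ scan f j
      idle = scan-idle f (toℕ m) j≤m (<⇒≤ m<e) λ m′ _ m′<m adj′ →
        <⇒≱ m′<m (subst (m Fin.≤_) (strictlyInverseˡ U m′)
          (min∞-lower (to U) _ _ eq (subst₂ Adj (sym (U≗ e)) (sym (U≗ m′)) adj′)))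

    -- Each slide advances the scan by at least one stage until e is reached. As `toℕ e < size D`,
    -- the `size D` slides of `jeuDeTaquin` complete the scan.
    slides-scan : ∀ {T : Tabloid D} → from T ≗ f → ∀ i →
                  ∃[ j ] j ≤ toℕ e × (i ≤ j ⊎ j ≡ toℕ e) × from (fold T (slide e) i) ≗ scan f j
    slides-scan T≗ zero    = 0 , z≤n , inj₁ z≤n , T≗
    slides-scan {T} T≗ (suc i) with slides-scan T≗ i
    ... | j , j≤e , reached , U≗ with slide-scan (fold T (slide e) i) j j≤e U≗ | reached
    ...   | j′ , j′≤e , inj₂ j′≡e , ≗ | _         = j′ , j′≤e , inj₂ j′≡e , ≗
    ...   | j′ , j′≤e , inj₁ j<j′ , ≗ | inj₁ i≤j  = j′ , j′≤e , inj₁ (ℕ.≤-<-trans i≤j j<j′) , ≗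
    ...   | j′ , j′≤e , inj₁ j<j′ , ≗ | inj₂ refl = contradiction j′≤e (<⇒≱ j<j′)

    jeuDeTaquin-scan : ∀ {T : Tabloid D} → from T ≗ f → from (jeuDeTaquin e T) ≗ scan f (toℕ e)
    jeuDeTaquin-scan T≗ with slides-scan T≗ (size D)
    ... | j , j≤e , inj₁ n≤j  , _ = contradiction (≤-trans n≤j j≤e) (<⇒≱ (toℕ<n e))
    ... | _ , _   , inj₂ refl , ≗ = ≗

-- Modified jeu de taquin and its symmetry.

-- The right fold over the elements from index k on, arranged so that stage 0 of `tabloids` below is
-- `MJ` by definition.
stage : ∀ {A B : Set} → (A → B → B) → B → ∀ {n} → (Fin n → A) → ℕ → B
stage f z         xs zero    = Vector.foldr f z xs
stage f z {zero}  xs (suc k) = z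
stage f z {suc n} xs (suc k) = stage f z (xs ∘ Fin.suc) k

stage-last : ∀ {A B : Set} (f : A → B → B) z {n} (xs : Fin n → A) → stage f z xs n ≡ z
stage-last f z {zero}  xs = refl
stage-last f z {suc n} xs = stage-last f z (xs ∘ Fin.suc)

stage-step : ∀ {A B : Set} (f : A → B → B) z {n} (xs : Fin n → A) k →
             stage f z xs (toℕ k) ≡ f (xs k) (stage f z xs (suc (toℕ k)))
stage-step f z xs Fin.zero    = refl
stage-step f z xs (Fin.suc k) = stage-step f z (xs ∘ Fin.suc) k

module _ {D : SkewShape} where

  MJ-growth : ∀ (S : StandardTableau D) (π : Permutation′ (size D)) →
              Growth Adj π (from (tabloid S)) (from (MJ S (relabel S π)))
  MJ-growth S π = growth F F-last F-step
    where
    T = tabloid S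

    adj? : Decidable Adj
    adj? = adjacent? T

    open Sifting adj? π (from T) (toℕ ∘ to T) (λ k → cong toℕ (strictlyInverseˡ T k)) (standard-adj S)

    -- This is the form to which `MJ` unfolds; `strictlyInverseˡ` reduces it to `π ⟨$⟩ʳ k` in
    -- `F-step`.
    entries : Fin (size D) → Fin (size D)
    entries k = π ⟨$⟩ʳ to T (from T k)

    tabloids : ℕ → Tabloid D
    tabloids = stage jeuDeTaquin (relabel S π) entries

    F : ℕ → Fin (size D) → Cell D
    F = from ∘ tabloids

    F-last : ∀ a → F (size D) a ≡ from T (π ⟨$⟩ˡ a)
    F-last a = cong (λ U → from U a) (stage-last jeuDeTaquin (relabel S π) entries)

    F-step : ∀ k → Sorted (suc (toℕ k)) (F (suc (toℕ k))) →
             F (toℕ k) ≗ Scan.scan adj? (π ⟨$⟩ʳ k) (F (suc (toℕ k))) (toℕ (π ⟨$⟩ʳ k))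
    F-step k s a
      rewrite stage-step jeuDeTaquin (relabel S π) entries k | strictlyInverseˡ T k =
      jeuDeTaquin-scan adj? (π ⟨$⟩ʳ k) _ (λ j j≤e → Row.Sifted.after (Row.sifted k s j j≤e))
        {T = tabloids (suc (toℕ k))} (λ _ → refl) a

  -- `_≈_` compares tabloids cell by cell, growth diagrams entry by entry; this lemma and the next
  -- pass between the two.
  from-≗ : {T U : Tabloid D} → T ≈ U → from T ≗ from U
  from-≗ {T} {U} T≈U a = begin
    from T a                   ≡⟨ strictlyInverseʳ U (from T a) ⟨
    from U (to U (from T a))   ≡⟨ cong (from U) (T≈U (from T a)) ⟨
    from U (to T (from T a))   ≡⟨ cong (from U) (strictlyInverseˡ T a) ⟩
    from U a                   ∎
    where open ≡-Reasoning

  ≈-from : {T U : Tabloid D} → from T ≗ from U → T ≈ U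
  ≈-from {T} {U} T≗U c = begin
    to T c                   ≡⟨ strictlyInverseˡ U (to T c) ⟨
    to U (from U (to T c))   ≡⟨ cong (to U) (T≗U (to T c)) ⟨
    to U (from T (to T c))   ≡⟨ cong (to U) (strictlyInverseʳ T c) ⟩
    to U c                   ∎
    where open ≡-Reasoning

  MJ-inverse : ∀ (P Q : StandardTableau D) (π : Permutation′ (size D)) →
               MJ P (relabel P π) ≈ tabloid Q → MJ Q (relabel Q (flip π)) ≈ tabloid P
  MJ-inverse P Q π eq = ≈-from {MJ Q (relabel Q (flip π))} {tabloid P}
    (growth-unique (sym ∘ from-≗ {MJ P (relabel P π)} {tabloid Q} eq)
      (MJ-growth Q (flip π)) (growth-transpose (MJ-growth P π)))

theorem1 : (D : SkewShape) (P Q : StandardTableau D) (π : Permutation′ (size D)) →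
    (MJ P (relabel P π) ≈ tabloid Q) ⇔ (MJ Q (relabel Q (flip π)) ≈ tabloid P)
-- The converse is the same implication for `flip π`, as `flip (flip π)` is `π` by definition.
theorem1 D P Q π = mk⇔ (MJ-inverse P Q π) (MJ-inverse Q P (flip π))
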